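{- Let $n\ge 3$ be an integer and let $\mathscr{A}$ and $\mathscr{B}$ be two cross-intersecting antichains on $\mathbb{N}_n$. Then $$|\mathscr{A}|+|\mathscr{B}|\le \binom{n}{\lfloor (n+1)/2\rfloor}+\binom{n}{\lceil (n+1)/2\rceil}.$$ Furthermore, equality holds if and only if $\{\mathscr{A},\mathscr{B}\}=\left\{\binom{\mathbb{N}_n}{\lfloor (n+1)/2\rfloor},\binom{\mathbb{N}_n}{\lceil (n+1)/2\rceil}\right\}$.
   Context: For a positive integer $n$, $\mathbb{N}_n=\{1,2,\ldots,n\}$, and for $0\le k\le n$, $\binom{\mathbb{N}_n}{k}$ denotes the collection of all $k$-element subsets of $\mathbb{N}_n$. An antichain (or Sperner family) on $\mathbb{N}_n$ is a collection $\mathscr{A}$ of subsets of $\mathbb{N}_n$ such that $X\not\subseteq Y$ for all distinct $X,Y\in\mathscr{A}$. Two families $\mathscr{A},\mathscr{B}\subseteq 2^{\mathbb{N}_n}$ are cross-intersecting if $A\cap B\neq\emptyset$ for all $A\in\mathscr{A}$ and all $B\in\mathscr{B}$. -}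

module Defs where

open import Level using (0ℓ)
open import Data.Nat using (ℕ)
open import Data.Fin.Subset using (Subset; ∣_∣; _∩_; Nonempty; _⊈_)
open import Data.List using (List; length)
import Data.List.Membership.Propositional as List
open import Data.List.Relation.Unary.Unique.Propositional using (Unique)
open import Data.Sum using (_⊎_)
open import Relation.Binary.PropositionalEquality using (_≡_; _≢_)
open import Relation.Unary using (Pred; _≐_)

-- A finite family of subsets of an n-element ground set, given by a
-- repetition-free enumeration, so that the length of the list is the
-- cardinality of the family.  The ground set {1,…,n} is modelled by Fin n.
record Family (n : ℕ) : Set where
  field
    members : List (Subset n)
    unique  : Unique members

open Family public

card : ∀ {n} → Family n → ℕ
card 𝒜 = length (members 𝒜)

-- The order of the enumeration carries no information: families are
-- compared through their membership predicates, up to _≐_.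
⟦_⟧ : ∀ {n} → Family n → Pred (Subset n) 0ℓ
⟦ 𝒜 ⟧ X = X List.∈ members 𝒜

Antichain : ∀ {n} → Family n → Set
Antichain 𝒜 = ∀ {X Y} → ⟦ 𝒜 ⟧ X → ⟦ 𝒜 ⟧ Y → X ≢ Y → X ⊈ Y

CrossIntersecting : ∀ {n} → Family n → Family n → Set
CrossIntersecting 𝒜 ℬ = ∀ {X Y} → ⟦ 𝒜 ⟧ X → ⟦ ℬ ⟧ Y → Nonempty (X ∩ Y)

-- All k-element subsets of the ground set.
Layer : (n k : ℕ) → Pred (Subset n) 0ℓ
Layer n k X = ∣ X ∣ ≡ k

-- The unordered pair {P , Q}, as a set of families.  Members are compared by
-- _≐_, since predicates with the same elements need not be equal under _≡_.
｛_,_｝ : ∀ {n} → Pred (Subset n) 0ℓ → Pred (Subset n) 0ℓ →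
        Pred (Pred (Subset n) 0ℓ) 0ℓ
｛ P , Q ｝ F = (F ≐ P) ⊎ (F ≐ Q)

{-# OPTIONS --safe #-}
module Submission where

-- Replace ℬ by 𝒬 = {∁ B : B ∈ ℬ}: then 𝒜 and 𝒬 are antichains and no member of 𝒜
-- lies inside a member of 𝒬; in particular they are disjoint.  Give a set of size i the
-- weight i!(n − i)!, which is n! divided by the size of its layer.  By LYM each of the two
-- antichains weighs at most n!, and since at most n C p sets lie on a lightest layer p and
-- all others weigh at least as much as those of the second-lightest layer q, the families
-- have at most n C p + n C q members together.
--
-- Equality forces equality in both LYM inequalities.  LYM is proved by double counting
-- the covering pairs X ⋖ Y against the indicator of the up-closure; equality makes
-- the up-closure stable under exchanging one element, so connectivity of the Johnson graph
-- shows that a tight antichain is a full layer.  It remains to see which layers.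

open import Defs
open import Data.Bool.Properties using () renaming (_≟_ to _≟ᵇ_)
open import Data.Fin.Subset using (Subset; inside; outside; ∣_∣; ∁; ⊤; _⊆_; _∩_; Nonempty)
open import Data.Fin.Subset.Properties
  using (_⊆?_; ⊆-refl; ⊆-trans; anySubset?; p⊆q⇒∣p∣≤∣q∣; ∣⊤∣≡n; out⊆; s⊆s; drop-∷-⊆;
         x∈p∩q⁻; x∈∁p⇒x∉p; p⊆q⇒∁p⊇∁q; ∣∁p∣≡n∸∣p∣)
open import Data.List using (List; []; _∷_; length)
import Data.List.Membership.DecPropositional as DecMembership
open import Data.List.Membership.Propositional using (_∈_)
open import Data.List.Relation.Unary.All as All using ([]; _∷_)
open import Data.List.Relation.Unary.AllPairs using ([]; _∷_)
open import Data.List.Relation.Unary.Any using (here; there)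
open import Data.List.Relation.Unary.Unique.Propositional using (Unique)
open import Data.Nat
  using (ℕ; zero; suc; pred; _+_; _*_; _∸_; _≤_; _<_; _≥_; z≤n; s≤s; _!; _≟_; NonZero; ⌊_/2⌋; ⌈_/2⌉)
open import Data.Nat.Combinatorics using (_C_; nCk+nC[k+1]≡[n+1]C[k+1]; k![n∸k]!∣n!)
open import Data.Nat.Combinatorics.Specification using (nCk≡n!/k![n-k]!; k>n⇒nCk≡0)
open import Data.Nat.DivMod using (m/n*n≡m)
open import Data.Nat.Properties hiding (_≟_)
open import Data.Nat.Tactic.RingSolver using (solve-∀)
open import Data.Product as Product using (∃; ∃₂; _×_; _,_; proj₁; proj₂)
open import Data.Sum as Sum using (_⊎_; inj₁; inj₂; [_,_]′)
open import Data.Vec using ([]; _∷_; here)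
open import Data.Vec.Properties using (≡-dec)
open import Function using (_∘_; id)
open import Function.Bundles using (_⇔_; mk⇔)
open import Level using (0ℓ)
open import Relation.Binary.Definitions using (DecidableEquality; tri<; tri≈; tri>)
open import Relation.Binary.PropositionalEquality
open import Relation.Nullary using (Dec; yes; no; ¬_; contradiction)
open import Relation.Nullary.Decidable using (_×-dec_; decidable-stable)
open import Relation.Unary using (Pred; Decidable; _≐_)
open import Relation.Unary.Properties using (≐-refl; ≐-sym; ≐-trans)

private
  variable
    n : ℕ
    A B : Set

-- Indicators and sums over all subsets

ind : Dec A → ℕ
ind (yes _) = 1
ind (no _)  = 0

ind≤1 : (d : Dec A) → ind d ≤ 1
ind≤1 (yes _) = ≤-refl
ind≤1 (no _)  = z≤n

ind-yes : (d : Dec A) → A → ind d ≡ 1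
ind-yes (yes _) _ = refl
ind-yes (no ¬a) a = contradiction a ¬a

ind-no : (d : Dec A) → ¬ A → ind d ≡ 0
ind-no (yes a) ¬a = contradiction a ¬a
ind-no (no _)  _  = refl

ind-true : (d : Dec A) → 1 ≤ ind d → A
ind-true (yes a) _ = a

infix 4 _≟ˢ_
_≟ˢ_ : DecidableEquality (Subset n)
_≟ˢ_ = ≡-dec _≟ᵇ_

∑ : (Subset n → ℕ) → ℕ
∑ {zero}  f = f []
∑ {suc n} f = ∑ (f ∘ (outside ∷_)) + ∑ (f ∘ (inside ∷_))

∑-cong : {f g : Subset n → ℕ} → (∀ X → f X ≡ g X) → ∑ f ≡ ∑ g
∑-cong {zero}  f≡g = f≡g []
∑-cong {suc n} f≡g = cong₂ _+_ (∑-cong (f≡g ∘ (outside ∷_))) (∑-cong (f≡g ∘ (inside ∷_)))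

∑-mono : {f g : Subset n → ℕ} → (∀ X → f X ≤ g X) → ∑ f ≤ ∑ g
∑-mono {zero}  f≤g = f≤g []
∑-mono {suc n} f≤g = +-mono-≤ (∑-mono (f≤g ∘ (outside ∷_))) (∑-mono (f≤g ∘ (inside ∷_)))

∑-+ : (f g : Subset n → ℕ) → ∑ (λ X → f X + g X) ≡ ∑ f + ∑ g
∑-+ {zero}  f g = refl
∑-+ {suc n} f g =
  trans (cong₂ _+_ (∑-+ (f ∘ (outside ∷_)) (g ∘ (outside ∷_))) (∑-+ (f ∘ (inside ∷_)) (g ∘ (inside ∷_))))
        (interchange (∑ (f ∘ (outside ∷_))) _ _ _)
  where
  interchange : ∀ a b c d → (a + b) + (c + d) ≡ (a + c) + (b + d)
  interchange = solve-∀

∑-*ʳ : (f : Subset n → ℕ) (c : ℕ) → ∑ (λ X → f X * c) ≡ ∑ f * c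
∑-*ʳ {zero}  f c = refl
∑-*ʳ {suc n} f c =
  trans (cong₂ _+_ (∑-*ʳ (f ∘ (outside ∷_)) c) (∑-*ʳ (f ∘ (inside ∷_)) c))
        (sym (*-distribʳ-+ c (∑ (f ∘ (outside ∷_))) _))

∑-0 : {f : Subset n → ℕ} → (∀ X → f X ≡ 0) → ∑ f ≡ 0
∑-0 {zero}  f≡0 = f≡0 []
∑-0 {suc n} f≡0 = cong₂ _+_ (∑-0 (f≡0 ∘ (outside ∷_))) (∑-0 (f≡0 ∘ (inside ∷_)))

+-squeeze : ∀ {a b c d} → a ≤ c → b ≤ d → c + d ≤ a + b → c ≤ a × d ≤ b
+-squeeze {a} {b} {c} {d} a≤c b≤d le =
  +-cancelʳ-≤ b c a (≤-trans (+-monoʳ-≤ c b≤d) le) ,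
  +-cancelˡ-≤ a d b (≤-trans (+-monoˡ-≤ d a≤c) le)

-- Pointwise inequalities whose totals agree have no slack at any set. Every equality case below is
-- extracted in this way.
∑-squeeze : {f g : Subset n → ℕ} → (∀ X → f X ≤ g X) → ∑ g ≤ ∑ f → ∀ X → g X ≤ f X
∑-squeeze {zero}  f≤g le [] = le
∑-squeeze {suc n} f≤g le (s ∷ X)
  with +-squeeze (∑-mono (f≤g ∘ (outside ∷_))) (∑-mono (f≤g ∘ (inside ∷_))) le
∑-squeeze {suc n} f≤g le (outside ∷ X) | le₀ , _ = ∑-squeeze (f≤g ∘ (outside ∷_)) le₀ X
∑-squeeze {suc n} f≤g le (inside ∷ X)  | _ , le₁ = ∑-squeeze (f≤g ∘ (inside ∷_)) le₁ X

∑-∁ : (f : Subset n → ℕ) → ∑ (f ∘ ∁) ≡ ∑ f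
∑-∁ {zero}  f = refl
∑-∁ {suc n} f =
  trans (cong₂ _+_ (∑-∁ (f ∘ (inside ∷_))) (∑-∁ (f ∘ (outside ∷_)))) (+-comm (∑ (f ∘ (inside ∷_))) _)

∑-single : (Z : Subset n) {f : Subset n → ℕ} → (∀ X → X ≢ Z → f X ≡ 0) → ∑ f ≡ f Z
∑-single []            f≡0 = refl
∑-single (outside ∷ Z) {f} f≡0 =
  trans (cong₂ _+_ (∑-single Z (λ X X≢Z → f≡0 (outside ∷ X) λ { refl → X≢Z refl }))
                   (∑-0 (λ X → f≡0 (inside ∷ X) λ ())))
        (+-identityʳ _)
∑-single (inside ∷ Z)  {f} f≡0 =
  cong₂ _+_ (∑-0 (λ X → f≡0 (outside ∷ X) λ ()))
            (∑-single Z (λ X X≢Z → f≡0 (inside ∷ X) λ { refl → X≢Z refl }))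

∑-δ : (Z : Subset n) (g : Subset n → ℕ) → ∑ (λ X → ind (Z ≟ˢ X) * g X) ≡ g Z
∑-δ Z g = trans
  (∑-single Z (λ X X≢Z → cong (_* g X) (ind-no (Z ≟ˢ X) (X≢Z ∘ sym))))
  (trans (cong (_* g Z) (ind-yes (Z ≟ˢ Z) refl)) (*-identityˡ (g Z)))

-- Covering pairs and sums over covers

infix 4 _⋖_
data _⋖_ : Subset n → Subset n → Set where
  here  : {X : Subset n} → outside ∷ X ⋖ inside ∷ X
  there : ∀ {s} {X Y : Subset n} → X ⋖ Y → s ∷ X ⋖ s ∷ Y

⋖⇒⊆ : {X Y : Subset n} → X ⋖ Y → X ⊆ Y
⋖⇒⊆ here        = out⊆ ⊆-refl
⋖⇒⊆ (there X⋖Y) = s⊆s (⋖⇒⊆ X⋖Y)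

⋖⇒∣∣ : {X Y : Subset n} → X ⋖ Y → ∣ Y ∣ ≡ suc ∣ X ∣
⋖⇒∣∣ here                  = refl
⋖⇒∣∣ (there {s = outside} X⋖Y) = ⋖⇒∣∣ X⋖Y
⋖⇒∣∣ (there {s = inside} X⋖Y)  = cong suc (⋖⇒∣∣ X⋖Y)

-- `∑↓ g Y` adds `g` over the lower covers of `Y`, and `∑↑ g X` over the upper covers of `X`. At
-- each position at most one cover changes the head; the others change the tail.
∑↓ : (Subset n → ℕ) → Subset n → ℕ
∑↓ g []            = 0
∑↓ g (outside ∷ Y) = ∑↓ (g ∘ (outside ∷_)) Y
∑↓ g (inside ∷ Y)  = g (outside ∷ Y) + ∑↓ (g ∘ (inside ∷_)) Y

∑↑ : (Subset n → ℕ) → Subset n → ℕ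
∑↑ g []            = 0
∑↑ g (outside ∷ X) = g (inside ∷ X) + ∑↑ (g ∘ (outside ∷_)) X
∑↑ g (inside ∷ X)  = ∑↑ (g ∘ (inside ∷_)) X

-- Both sides add `h Y * g X` over the pairs `X ⋖ Y`. In the induction the pairs differing at the
-- head give the term in `h₁` and `g₀`, which changes sides.
∑↓-∑↑-adjoint : (g h : Subset n → ℕ) → ∑ (λ Y → h Y * ∑↓ g Y) ≡ ∑ (λ X → ∑↑ h X * g X)
∑↓-∑↑-adjoint {zero}  g h = *-zeroʳ (h [])
∑↓-∑↑-adjoint {suc n} g h = begin
  ∑ (λ Y → h₀ Y * ∑↓ g₀ Y) + ∑ (λ Y → h₁ Y * (g₀ Y + ∑↓ g₁ Y))
    ≡⟨ cong (∑ (λ Y → h₀ Y * ∑↓ g₀ Y) +_)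
         (trans (∑-cong (λ Y → *-distribˡ-+ (h₁ Y) (g₀ Y) _)) (∑-+ (λ Y → h₁ Y * g₀ Y) _)) ⟩
  ∑ (λ Y → h₀ Y * ∑↓ g₀ Y) + (∑ (λ Y → h₁ Y * g₀ Y) + ∑ (λ Y → h₁ Y * ∑↓ g₁ Y))
    ≡⟨ cong₂ (λ a b → a + (∑ (λ Y → h₁ Y * g₀ Y) + b)) (∑↓-∑↑-adjoint g₀ h₀) (∑↓-∑↑-adjoint g₁ h₁) ⟩
  ∑ (λ X → ∑↑ h₀ X * g₀ X) + (∑ (λ Y → h₁ Y * g₀ Y) + ∑ (λ X → ∑↑ h₁ X * g₁ X))
    ≡⟨ rearrange (∑ (λ X → ∑↑ h₀ X * g₀ X)) (∑ (λ Y → h₁ Y * g₀ Y)) _ ⟩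
  (∑ (λ Y → h₁ Y * g₀ Y) + ∑ (λ X → ∑↑ h₀ X * g₀ X)) + ∑ (λ X → ∑↑ h₁ X * g₁ X)
    ≡⟨ cong (_+ ∑ (λ X → ∑↑ h₁ X * g₁ X))
         (trans (sym (∑-+ (λ Y → h₁ Y * g₀ Y) _)) (∑-cong (λ X → sym (*-distribʳ-+ (g₀ X) (h₁ X) _)))) ⟩
  ∑ (λ X → (h₁ X + ∑↑ h₀ X) * g₀ X) + ∑ (λ X → ∑↑ h₁ X * g₁ X) ∎
  where
  open ≡-Reasoning
  g₀ = g ∘ (outside ∷_)
  g₁ = g ∘ (inside ∷_)
  h₀ = h ∘ (outside ∷_)
  h₁ = h ∘ (inside ∷_)
  rearrange : ∀ a b c → a + (b + c) ≡ (b + a) + c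
  rearrange = solve-∀

∑↓-0 : {g : Subset n → ℕ} (Y : Subset n) → (∀ {X} → X ⋖ Y → g X ≡ 0) → ∑↓ g Y ≡ 0
∑↓-0 []            g≡0 = refl
∑↓-0 (outside ∷ Y) g≡0 = ∑↓-0 Y (g≡0 ∘ there)
∑↓-0 (inside ∷ Y)  g≡0 = cong₂ _+_ (g≡0 here) (∑↓-0 Y (g≡0 ∘ there))

∑↓≤ : {g : Subset n → ℕ} → (∀ X → g X ≤ 1) → ∀ Y → ∑↓ g Y ≤ ∣ Y ∣
∑↓≤ g≤1 []            = z≤n
∑↓≤ g≤1 (outside ∷ Y) = ∑↓≤ (g≤1 ∘ (outside ∷_)) Y
∑↓≤ g≤1 (inside ∷ Y)  = +-mono-≤ (g≤1 _) (∑↓≤ (g≤1 ∘ (inside ∷_)) Y)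

-- A set `Y` has exactly `∣ Y ∣` lower covers, so values at most 1 that add up to `∣ Y ∣` must all
-- be 1.
∑↓-saturated : {g : Subset n → ℕ} → (∀ X → g X ≤ 1) →
               ∀ {X Y} → ∣ Y ∣ ≤ ∑↓ g Y → X ⋖ Y → 1 ≤ g X
∑↓-saturated g≤1 {Y = inside ∷ Y} le here =
  proj₁ (+-squeeze (g≤1 _) (∑↓≤ (g≤1 ∘ (inside ∷_)) Y) le)
∑↓-saturated g≤1 {Y = outside ∷ Y} le (there X⋖Y) = ∑↓-saturated (g≤1 ∘ (outside ∷_)) le X⋖Y
∑↓-saturated g≤1 {Y = inside ∷ Y} le (there X⋖Y) =
  ∑↓-saturated (g≤1 ∘ (inside ∷_)) (proj₂ (+-squeeze (g≤1 _) (∑↓≤ (g≤1 ∘ (inside ∷_)) Y) le)) X⋖Y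

-- All `∣ ∁ X ∣` upper covers of `X` have the same size. The function `φ` is arbitrary so that the
-- induction can absorb the head into its arguments.
∑↑-sizes : (φ : ℕ → ℕ → ℕ) (X : Subset n) →
           ∑↑ (λ Y → φ ∣ Y ∣ ∣ ∁ Y ∣) X ≡ ∣ ∁ X ∣ * φ (suc ∣ X ∣) (pred ∣ ∁ X ∣)
∑↑-sizes φ []            = refl
∑↑-sizes φ (inside ∷ X)  = ∑↑-sizes (φ ∘ suc) X
∑↑-sizes φ (outside ∷ X) =
  trans (cong (φ (suc ∣ X ∣) ∣ ∁ X ∣ +_) (∑↑-sizes (λ i j → φ i (suc j)) X))
        (cong (φ (suc ∣ X ∣) ∣ ∁ X ∣ +_) (shift ∣ ∁ X ∣))
  where
  shift : ∀ j → j * φ (suc ∣ X ∣) (suc (pred j)) ≡ j * φ (suc ∣ X ∣) j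
  -- `suc (pred j)` differs from `j` only at 0, where the factor `j` vanishes.
  shift zero    = refl
  shift (suc j) = refl

-- Sizes of sets and of their complements

∣∁∣≡0⇒⊤ : (X : Subset n) → ∣ ∁ X ∣ ≡ 0 → X ≡ ⊤
∣∁∣≡0⇒⊤ []           _  = refl
∣∁∣≡0⇒⊤ (inside ∷ X) eq = cong (inside ∷_) (∣∁∣≡0⇒⊤ X eq)

∣X∣+∣∁X∣≡n : (X : Subset n) → ∣ X ∣ + ∣ ∁ X ∣ ≡ n
∣X∣+∣∁X∣≡n []            = refl
∣X∣+∣∁X∣≡n (inside ∷ X)  = cong suc (∣X∣+∣∁X∣≡n X)
∣X∣+∣∁X∣≡n (outside ∷ X) = trans (+-suc ∣ X ∣ _) (cong suc (∣X∣+∣∁X∣≡n X))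

⊆∧≡∣∣⇒≡ : (X Y : Subset n) → X ⊆ Y → ∣ Y ∣ ≤ ∣ X ∣ → X ≡ Y
⊆∧≡∣∣⇒≡ []            []            _   _  = refl
⊆∧≡∣∣⇒≡ (outside ∷ X) (outside ∷ Y) X⊆Y le = cong (outside ∷_) (⊆∧≡∣∣⇒≡ X Y (drop-∷-⊆ X⊆Y) le)
⊆∧≡∣∣⇒≡ (inside ∷ X)  (inside ∷ Y)  X⊆Y (s≤s le) = cong (inside ∷_) (⊆∧≡∣∣⇒≡ X Y (drop-∷-⊆ X⊆Y) le)
⊆∧≡∣∣⇒≡ (outside ∷ X) (inside ∷ Y)  X⊆Y le =
  contradiction (≤-trans le (p⊆q⇒∣p∣≤∣q∣ (drop-∷-⊆ X⊆Y))) 1+n≰n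
⊆∧≡∣∣⇒≡ (inside ∷ X)  (outside ∷ Y) X⊆Y le with () ← X⊆Y here

subset-of-size : (Y : Subset n) {k : ℕ} → k ≤ ∣ Y ∣ → ∃ λ X → X ⊆ Y × ∣ X ∣ ≡ k
subset-of-size []            z≤n = [] , ⊆-refl , refl
subset-of-size (outside ∷ Y) le with subset-of-size Y le
... | X , X⊆Y , eq = outside ∷ X , s⊆s X⊆Y , eq
subset-of-size (inside ∷ Y) {zero} le with subset-of-size Y z≤n
... | X , X⊆Y , eq = outside ∷ X , out⊆ X⊆Y , eq
subset-of-size (inside ∷ Y) {suc k} (s≤s le) with subset-of-size Y le
... | X , X⊆Y , eq = inside ∷ X , s⊆s X⊆Y , cong suc eq

lower-cover : (Y : Subset n) {k : ℕ} → ∣ Y ∣ ≡ suc k → ∃ λ X → X ⋖ Y × ∣ X ∣ ≡ k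
lower-cover (inside ∷ Y)  eq = outside ∷ Y , here , suc-injective eq
lower-cover (outside ∷ Y) eq with lower-cover Y eq
... | X , X⋖Y , eq′ = outside ∷ X , there X⋖Y , eq′

-- Exchanging one element within a layer

SwapClosed : (Subset n → Set) → Set
SwapClosed P = ∀ {Z Z′ Y} → Z ⋖ Y → Z′ ⋖ Y → P Z → P Z′

-- Connectivity of the Johnson graph.  When the heads differ, an element
-- is moved across from the tail of the set whose head is outside.
swap-connected : {P : Subset n → Set} → SwapClosed P → ∀ X Z → ∣ X ∣ ≡ ∣ Z ∣ → P X → P Z
swap-connected sc []            []            _  p = p
swap-connected sc (outside ∷ X) (outside ∷ Z) eq p =
  swap-connected (λ a b → sc (there a) (there b)) X Z eq p
swap-connected sc (inside ∷ X)  (inside ∷ Z)  eq p =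
  swap-connected (λ a b → sc (there a) (there b)) X Z (suc-injective eq) p
swap-connected sc (inside ∷ X)  (outside ∷ Z) eq p with lower-cover Z (sym eq)
... | Z′ , Z′⋖Z , eq′ =
  sc (there Z′⋖Z) here (swap-connected (λ a b → sc (there a) (there b)) X Z′ (sym eq′) p)
swap-connected sc (outside ∷ X) (inside ∷ Z)  eq p with lower-cover X eq
... | X′ , X′⋖X , eq′ =
  swap-connected (λ a b → sc (there a) (there b)) X′ Z eq′ (sc here (there X′⋖X) p)

-- Weights and the LYM inequality

w : ℕ → ℕ → ℕ
w i j = i ! * j !

-- The number of maximal chains through the set.
weight : Subset n → ℕ
weight X = w ∣ X ∣ ∣ ∁ X ∣

IsAntichain : (Subset n → Set) → Set
IsAntichain P = ∀ {X Y} → P X → P Y → X ⊆ Y → X ≡ Y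

module _ {P : Subset n → Set} (P? : Decidable P) (P-antichain : IsAntichain P) where

  private
    f : Subset n → ℕ
    f X = ind (P? X)

    Above : Subset n → Set
    Above Y = ∃ λ X → P X × X ⊆ Y

    above? : Decidable Above
    above? Y = anySubset? (λ X → P? X ×-dec (X ⊆? Y))

    h : Subset n → ℕ
    h Y = ind (above? Y)

    above-⋖ : ∀ {X Y} → X ⋖ Y → Above X → Above Y
    above-⋖ X⋖Y (W , PW , W⊆X) = W , PW , ⊆-trans W⊆X (⋖⇒⊆ X⋖Y)

    ¬above-⋖ : ∀ {X Y} → P Y → X ⋖ Y → ¬ Above X
    ¬above-⋖ {X} {Y} PY X⋖Y (W , PW , W⊆X) with refl ← P-antichain PW PY (⊆-trans W⊆X (⋖⇒⊆ X⋖Y)) =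
      1+n≰n (subst (_≤ ∣ X ∣) (⋖⇒∣∣ X⋖Y) (p⊆q⇒∣p∣≤∣q∣ W⊆X))

    -- Chosen so that ∑↑ u is the weight, except at ⊤ where it is 0.  The value at the
    -- empty set is irrelevant, since ∑↓ vanishes there.
    u : Subset n → ℕ
    u Y = pred ∣ Y ∣ ! * ∣ ∁ Y ∣ !

    u*∣∣≤weight : ∀ Y → u Y * ∣ Y ∣ ≤ weight Y
    u*∣∣≤weight Y with ∣ Y ∣
    ... | zero  = subst (_≤ 0 ! * ∣ ∁ Y ∣ !) (sym (*-zeroʳ (0 ! * ∣ ∁ Y ∣ !))) z≤n
    ... | suc k = ≤-reflexive (swap (k !) (∣ ∁ Y ∣ !) (suc k))
      where
      swap : ∀ a b c → (a * b) * c ≡ (c * a) * b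
      swap = solve-∀

    ∑↑u : ∀ X → weight X * h X ≤ ∑↑ u X * h X + ind (⊤ ≟ˢ X) * n !
    ∑↑u X with ∣ ∁ X ∣ in eq
    -- Here `X` is `⊤`, which has no upper cover; the extra term `n !` pays for its weight.
    ... | zero with refl ← ∣∁∣≡0⇒⊤ X eq = begin
      (∣ ⊤ {n} ∣ ! * 1) * h ⊤   ≤⟨ *-monoʳ-≤ (∣ ⊤ {n} ∣ ! * 1) (ind≤1 (above? ⊤)) ⟩
      (∣ ⊤ {n} ∣ ! * 1) * 1     ≡⟨ trans (*-identityʳ _) (*-identityʳ _) ⟩
      ∣ ⊤ {n} ∣ !               ≡⟨ cong _! (∣⊤∣≡n n) ⟩
      n !                       ≡⟨ sym (*-identityˡ (n !)) ⟩
      1 * n !                   ≡⟨ cong (_* n !) (sym (ind-yes (⊤ {n} ≟ˢ ⊤) refl)) ⟩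
      ind (⊤ {n} ≟ˢ ⊤) * n !    ≤⟨ m≤n+m _ _ ⟩
      ∑↑ u ⊤ * h ⊤ + ind (⊤ {n} ≟ˢ ⊤) * n ! ∎
      where open ≤-Reasoning
    ... | suc j = ≤-trans (≤-reflexive (cong (_* h X) eq′)) (m≤m+n _ _)
      where
      swap : ∀ a b c → a * (c * b) ≡ c * (a * b)
      swap = solve-∀
      eq′ : ∣ X ∣ ! * (suc j * j !) ≡ ∑↑ u X
      eq′ = trans (swap (∣ X ∣ !) (j !) (suc j))
              (sym (trans (∑↑-sizes (λ a b → pred a ! * b !) X)
                          (cong (λ m → m * (∣ X ∣ ! * pred m !)) eq)))

    -- A member of the antichain has no lower cover in the up-closure, and neither has a set outside
    -- the up-closure. Any other set has at most `∣ Y ∣` lower covers there, each charged `u Y`.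
    local : ∀ Y → weight Y * f Y + u Y * ∑↓ h Y ≤ weight Y * h Y
    local Y with P? Y
    ... | yes PY = begin
      weight Y * 1 + u Y * ∑↓ h Y  ≡⟨ cong (λ m → weight Y * 1 + u Y * m)
                                        (∑↓-0 Y (λ X⋖Y → ind-no (above? _) (¬above-⋖ PY X⋖Y))) ⟩
      weight Y * 1 + u Y * 0       ≡⟨ cong (weight Y * 1 +_) (*-zeroʳ (u Y)) ⟩
      weight Y * 1 + 0             ≡⟨ +-identityʳ _ ⟩
      weight Y * 1                 ≡⟨ cong (weight Y *_) (sym (ind-yes (above? Y) (Y , PY , ⊆-refl))) ⟩
      weight Y * h Y               ∎
      where open ≤-Reasoning
    ... | no _ = subst (λ m → m + u Y * ∑↓ h Y ≤ weight Y * h Y) (sym (*-zeroʳ (weight Y))) bound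
      where
      open ≤-Reasoning
      bound : u Y * ∑↓ h Y ≤ weight Y * h Y
      bound with above? Y
      ... | yes _ = begin
        u Y * ∑↓ h Y  ≤⟨ *-monoʳ-≤ (u Y) (∑↓≤ (λ X → ind≤1 (above? X)) Y) ⟩
        u Y * ∣ Y ∣   ≤⟨ u*∣∣≤weight Y ⟩
        weight Y      ≡⟨ sym (*-identityʳ _) ⟩
        weight Y * 1  ∎
      ... | no ¬aY = begin
        u Y * ∑↓ h Y  ≡⟨ cong (u Y *_) (∑↓-0 Y (λ X⋖Y → ind-no (above? _) (¬aY ∘ above-⋖ X⋖Y))) ⟩
        u Y * 0       ≡⟨ *-zeroʳ (u Y) ⟩
        0             ≤⟨ z≤n ⟩
        weight Y * 0  ∎

    ∑local : ∑ (λ Y → weight Y * f Y + u Y * ∑↓ h Y) ≡ ∑ (λ Y → weight Y * f Y) + ∑ (λ X → ∑↑ u X * h X)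
    ∑local = trans (∑-+ (λ Y → weight Y * f Y) _)
                   (cong (∑ (λ Y → weight Y * f Y) +_) (∑↓-∑↑-adjoint h u))

    ∑weight*h≤ : ∑ (λ Y → weight Y * h Y) ≤ ∑ (λ X → ∑↑ u X * h X) + n !
    ∑weight*h≤ = ≤-trans (∑-mono ∑↑u)
      (≤-reflexive (trans (∑-+ (λ X → ∑↑ u X * h X) _)
                          (cong (∑ (λ X → ∑↑ u X * h X) +_) (∑-δ (⊤ {n}) (λ _ → n !)))))

  -- Add `local` over all `Y` and move the covering pairs to their lower ends by adjointness. Every
  -- set of the up-closure other than `⊤` then contributes its weight to both sides, so what remains
  -- is at most the `n !` charged at `⊤`.
  LYM : ∑ (λ X → weight X * ind (P? X)) ≤ n !
  LYM = +-cancelʳ-≤ (∑ (λ X → ∑↑ u X * h X)) _ _ (begin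
    ∑ (λ Y → weight Y * f Y) + ∑ (λ X → ∑↑ u X * h X) ≡⟨ sym ∑local ⟩
    ∑ (λ Y → weight Y * f Y + u Y * ∑↓ h Y)           ≤⟨ ∑-mono local ⟩
    ∑ (λ Y → weight Y * h Y)                          ≤⟨ ∑weight*h≤ ⟩
    ∑ (λ X → ∑↑ u X * h X) + n !                      ≡⟨ +-comm _ (n !) ⟩
    n ! + ∑ (λ X → ∑↑ u X * h X)                      ∎)
    where open ≤-Reasoning

  -- Equality in the LYM inequality

  module _ (tight : n ! ≤ ∑ (λ X → weight X * ind (P? X))) where

    private
      local-tight : ∀ Y → weight Y * h Y ≤ weight Y * f Y + u Y * ∑↓ h Y
      local-tight = ∑-squeeze local (begin
        ∑ (λ Y → weight Y * h Y)                          ≤⟨ ∑weight*h≤ ⟩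
        ∑ (λ X → ∑↑ u X * h X) + n !                      ≤⟨ +-monoʳ-≤ _ tight ⟩
        ∑ (λ X → ∑↑ u X * h X) + ∑ (λ Y → weight Y * f Y) ≡⟨ +-comm _ (∑ (λ Y → weight Y * f Y)) ⟩
        ∑ (λ Y → weight Y * f Y) + ∑ (λ X → ∑↑ u X * h X) ≡⟨ sym ∑local ⟩
        ∑ (λ Y → weight Y * f Y + u Y * ∑↓ h Y)           ∎)
        where open ≤-Reasoning

      -- A set covering one of the up-closure is in the up-closure but not in `P`. Equality in
      -- `local` must then come from its lower covers alone, so all of them lie in the up-closure.
      ∣∣≤∑↓ : ∀ {Z Y} → Z ⋖ Y → Above Z → ∣ Y ∣ ≤ ∑↓ h Y
      ∣∣≤∑↓ {Z} {Y} Z⋖Y aZ = *-cancelˡ-≤ (u Y) {{ pred ∣ Y ∣ !* ∣ ∁ Y ∣ !≢0 }} (begin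
        u Y * ∣ Y ∣                      ≤⟨ u*∣∣≤weight Y ⟩
        weight Y                         ≡⟨ sym (*-identityʳ _) ⟩
        weight Y * 1                     ≡⟨ cong (weight Y *_) (sym (ind-yes (above? Y) (above-⋖ Z⋖Y aZ))) ⟩
        weight Y * h Y                   ≤⟨ local-tight Y ⟩
        weight Y * f Y + u Y * ∑↓ h Y    ≡⟨ cong (λ m → weight Y * m + u Y * ∑↓ h Y)
                                              (ind-no (P? Y) (λ PY → ¬above-⋖ PY Z⋖Y aZ)) ⟩
        weight Y * 0 + u Y * ∑↓ h Y      ≡⟨ cong (_+ u Y * ∑↓ h Y) (*-zeroʳ (weight Y)) ⟩
        u Y * ∑↓ h Y                     ∎)
        where open ≤-Reasoning

      above-swap : SwapClosed Above
      above-swap Z⋖Y Z′⋖Y aZ =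
        ind-true (above? _) (∑↓-saturated (λ X → ind≤1 (above? X)) (∣∣≤∑↓ Z⋖Y aZ) Z′⋖Y)

      above-layer : ∀ {X} → P X → ∀ Z → ∣ X ∣ ≡ ∣ Z ∣ → Above Z
      above-layer PX Z eq = swap-connected above-swap _ Z eq (_ , PX , ⊆-refl)

      -- A subset `Z` of `Y` of size `∣ X ∣` is in the up-closure and so contains a member `W`. The
      -- antichain property makes `W` equal to `Y`, which does not fit into `Z`.
      ¬smaller : ∀ {X Y} → P X → P Y → ¬ ∣ X ∣ < ∣ Y ∣
      ¬smaller {X} {Y} PX PY lt with subset-of-size Y (<⇒≤ lt)
      ... | Z , Z⊆Y , ∣Z∣≡ with above-layer PX Z (sym ∣Z∣≡)
      ... | W , PW , W⊆Z with refl ← P-antichain PW PY (⊆-trans W⊆Z Z⊆Y) =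
        <⇒≱ lt (subst (∣ Y ∣ ≤_) ∣Z∣≡ (p⊆q⇒∣p∣≤∣q∣ W⊆Z))

      same-size : ∀ {X Y} → P X → P Y → ∣ X ∣ ≡ ∣ Y ∣
      same-size {X} {Y} PX PY with <-cmp ∣ X ∣ ∣ Y ∣
      ... | tri< lt _ _ = contradiction lt (¬smaller PX PY)
      ... | tri≈ _ eq _ = eq
      ... | tri> _ _ gt = contradiction gt (¬smaller PY PX)

      -- The member of `P` contained in `Z` has the common size of all members, which is that of
      -- `Z`, and therefore equals `Z`.
      layer⊆P : ∀ {X} → P X → ∀ Z → ∣ X ∣ ≡ ∣ Z ∣ → P Z
      layer⊆P PX Z eq with above-layer PX Z eq
      ... | W , PW , W⊆Z =
        subst P (⊆∧≡∣∣⇒≡ W Z W⊆Z (≤-reflexive (trans (sym eq) (same-size PX PW)))) PW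

    LYM-tight : ∃ λ X → P X × (∀ Z → P Z → ∣ Z ∣ ≡ ∣ X ∣) × (∀ Z → ∣ Z ∣ ≡ ∣ X ∣ → P Z)
    LYM-tight with anySubset? P?
    ... | yes (X , PX) = X , PX , (λ Z PZ → same-size PZ PX) , λ Z eq → layer⊆P PX Z (sym eq)
    -- The empty family has weight 0, which is less than `n !`.
    ... | no ¬∃P = contradiction
      (≤-trans tight (≤-reflexive (∑-0 (λ X → trans (cong (weight X *_) (ind-no (P? X) (λ PX → ¬∃P (X , PX))))
                                                    (*-zeroʳ (weight X))))))
      (<⇒≱ (1≤n! n))

-- Counting families and layers

ind-cong : (d : Dec A) (e : Dec B) → (A → B) → (B → A) → ind d ≡ ind e
ind-cong (yes a) e f g = sym (ind-yes e (f a))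
ind-cong (no ¬a) e f g = sym (ind-no e (¬a ∘ g))

count : {P : Subset n → Set} → Decidable P → ℕ
count P? = ∑ (λ X → ind (P? X))

count-cong : {P Q : Subset n → Set} (P? : Decidable P) (Q? : Decidable Q) → P ≐ Q → count P? ≡ count Q?
count-cong P? Q? (P⊆Q , Q⊆P) = ∑-cong (λ X → ind-cong (P? X) (Q? X) P⊆Q Q⊆P)

layer? : (k : ℕ) → Decidable (Layer n k)
layer? k X = ∣ X ∣ ≟ k

-- Splitting on the first element reproduces Pascal's rule.
count-layer : ∀ n k → count (layer? {n} k) ≡ n C k
count-layer zero    zero    = refl
count-layer zero    (suc k) = sym (k>n⇒nCk≡0 {0} {suc k} (s≤s z≤n))
count-layer (suc n) zero    =
  trans (cong₂ _+_ (count-layer n 0) (∑-0 {n} (λ X → ind-no (layer? 0 (inside ∷ X)) λ ()))) (+-identityʳ _)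
count-layer (suc n) (suc k) = begin
  count (layer? {n} (suc k)) + ∑ {n} (λ X → ind (layer? (suc k) (inside ∷ X)))
    ≡⟨ cong (count (layer? {n} (suc k)) +_)
         (∑-cong {n} (λ X → ind-cong (layer? (suc k) (inside ∷ X)) (layer? k X) suc-injective (cong suc))) ⟩
  count (layer? {n} (suc k)) + count (layer? {n} k)
    ≡⟨ cong₂ _+_ (count-layer n (suc k)) (count-layer n k) ⟩
  n C suc k + n C k ≡⟨ +-comm (n C suc k) _ ⟩
  n C k + n C suc k ≡⟨ nCk+nC[k+1]≡[n+1]C[k+1] n k ⟩
  suc n C suc k ∎
  where open ≡-Reasoning

count≐layer : {P : Subset n → Set} (P? : Decidable P) {k : ℕ} → P ≐ Layer n k → count P? ≡ n C k
count≐layer {n} P? {k} P≐L = trans (count-cong P? (layer? k) P≐L) (count-layer n k)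

_∈?_ : (X : Subset n) (xs : List (Subset n)) → Dec (X ∈ xs)
_∈?_ = DecMembership._∈?_ _≟ˢ_

-- The head of the list contributes the indicator of a single set, and `Unique` keeps it from being
-- counted again in the tail.
length≡count : {xs : List (Subset n)} → Unique xs → length xs ≡ count (_∈? xs)
length≡count {n} []                        = sym (∑-0 {n} λ X → ind-no (X ∈? []) λ ())
length≡count {xs = x ∷ xs} (x∉xs ∷ xs!) = sym (begin
  count (_∈? (x ∷ xs))                               ≡⟨ ∑-cong split ⟩
  ∑ (λ X → ind (x ≟ˢ X) * 1 + ind (X ∈? xs))         ≡⟨ ∑-+ (λ X → ind (x ≟ˢ X) * 1) _ ⟩
  ∑ (λ X → ind (x ≟ˢ X) * 1) + count (_∈? xs)        ≡⟨ cong₂ _+_ (∑-δ x (λ _ → 1)) (sym (length≡count xs!)) ⟩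
  suc (length xs)                                    ∎)
  where
  open ≡-Reasoning
  split : ∀ X → ind (X ∈? (x ∷ xs)) ≡ ind (x ≟ˢ X) * 1 + ind (X ∈? xs)
  split X with x ≟ˢ X
  ... | yes refl = trans (ind-yes (x ∈? (x ∷ xs)) (here refl))
                         (cong suc (sym (ind-no (x ∈? xs) (λ x∈xs → All.lookup x∉xs x∈xs refl))))
  ... | no x≢X   = ind-cong (X ∈? (x ∷ xs)) (X ∈? xs)
                     (λ { (here X≡x) → contradiction (sym X≡x) x≢X ; (there X∈xs) → X∈xs }) there

-- A full layer weighs exactly `n !`; this turns bounds on weights back into binomial coefficients.
C*w : ∀ i j → i + j ≡ n → (n C i) * w i j ≡ n !
C*w i j refl = begin
  ((i + j) C i) * (i ! * j !)                ≡⟨ cong (λ k → ((i + j) C i) * (i ! * k !)) (sym (m+n∸m≡n i j)) ⟩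
  ((i + j) C i) * (i ! * (i + j ∸ i) !)      ≡⟨ cong (_* (i ! * (i + j ∸ i) !)) (nCk≡n!/k![n-k]! (m≤m+n i j)) ⟩
  _                                          ≡⟨ m/n*n≡m (k![n∸k]!∣n! (m≤m+n i j)) ⟩
  (i + j) !                                  ∎
  where
  open ≡-Reasoning
  instance _ = i !* (i + j ∸ i) !≢0

-- Weights decrease toward the middle

w-comm : ∀ i j → w i j ≡ w j i
w-comm i j = *-comm (i !) (j !)

w≢0 : ∀ i j → NonZero (w i j)
w≢0 i j = i !* j !≢0

-- The two sides are `suc i` times and `suc j` times `w i j`.
w-step : ∀ {i j} → i < j → w (suc i) j < w i (suc j)
w-step {i} {j} i<j =
  subst₂ _<_ (eq₁ i (i !) (j !)) (eq₂ j (i !) (j !)) (*-monoˡ-< (w i j) {{w≢0 i j}} (s≤s i<j))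
  where
  eq₁ : ∀ i a b → suc i * (a * b) ≡ (suc i * a) * b
  eq₁ = solve-∀
  eq₂ : ∀ j a b → suc j * (a * b) ≡ a * (suc j * b)
  eq₂ = solve-∀

w-toward-middle : ∀ k {i j} → k + i ≤ j → w (k + i) j ≤ w i (k + j)
w-toward-middle zero    le = ≤-refl
w-toward-middle (suc k) {i} {j} le = begin
  w (suc k + i) j    ≡⟨ cong (λ a → w a j) (sym (+-suc k i)) ⟩
  w (k + suc i) j    ≤⟨ w-toward-middle k (≤-trans (≤-reflexive (+-suc k i)) le) ⟩
  w (suc i) (k + j)  ≤⟨ <⇒≤ (w-step (≤-trans (s≤s (m≤n+m i k)) (≤-trans le (m≤n+m j k)))) ⟩
  w i (suc k + j)    ∎
  where open ≤-Reasoning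

w-toward-middle-< : ∀ k {i j} → suc k + i ≤ j → w (suc k + i) j < w i (suc k + j)
w-toward-middle-< k {i} {j} le = begin-strict
  w (suc k + i) j    ≡⟨ cong (λ a → w a j) (sym (+-suc k i)) ⟩
  w (k + suc i) j    ≤⟨ w-toward-middle k (≤-trans (≤-reflexive (+-suc k i)) le) ⟩
  w (suc i) (k + j)  <⟨ w-step (≤-trans (s≤s (m≤n+m i k)) (≤-trans le (m≤n+m j k))) ⟩
  w i (suc k + j)    ∎
  where open ≤-Reasoning

-- With `c` written as `i + k`, `j` is `k + d`, and `k` strictly decreasing steps lead from `(i, j)`
-- to `(c, d)`. Equal weights therefore force `k` to be 0.
w-minimal : ∀ {c d i j} → c ≤ d → i ≤ c → i + j ≡ c + d → w c d ≤ w i j × (w i j ≤ w c d → i ≡ c)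
w-minimal {c} {d} {i} {j} c≤d i≤c eq with m≤n⇒∃[o]m+o≡n i≤c
... | k , refl with +-cancelˡ-≡ i j (k + d) (trans eq (+-assoc i k d))
... | refl rewrite +-comm i k = w-toward-middle k c≤d , tight k c≤d
  where
  tight : ∀ k → k + i ≤ d → w i (k + d) ≤ w (k + i) d → i ≡ k + i
  tight zero    _  _  = refl
  tight (suc k) le ge = contradiction ge (<⇒≱ (w-toward-middle-< k le))

-- Two disjoint antichains: from weights to cardinalities

module _ {P Q : Subset n → Set} (P? : Decidable P) (Q? : Decidable Q)
         (P-antichain : IsAntichain P) (Q-antichain : IsAntichain Q)
         (disjoint : ∀ {X} → P X → ¬ Q X)
         (p p′ q q′ : ℕ) (p+p′≡n : p + p′ ≡ n) (q+q′≡n : q + q′ ≡ n)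
         (wp≤wq : w p p′ ≤ w q q′)
         (wq-minimal : ∀ (X : Subset n) → ∣ X ∣ ≢ p → w q q′ ≤ weight X) where

  private
    v u M N a : ℕ
    v = w p p′
    u = w q q′
    M = n C p
    N = n C q

    -- `F` is the indicator of the two families together and `e` its restriction to layer `p`, so
    -- that `a` counts the members on that layer.
    F e : Subset n → ℕ
    F X = ind (P? X) + ind (Q? X)
    e X = ind (layer? p X) * F X
    a = ∑ e

    F≤1 : ∀ X → F X ≤ 1
    F≤1 X with P? X
    ... | yes PX = ≤-reflexive (cong suc (ind-no (Q? X) (disjoint PX)))
    ... | no _   = ind≤1 (Q? X)

    a≤M : a ≤ M
    a≤M = ≤-trans (∑-mono (λ X → ≤-trans (*-monoʳ-≤ (ind (layer? p X)) (F≤1 X)) (≤-reflexive (*-identityʳ _))))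
                  (≤-reflexive (count-layer n p))

    weight-p : ∀ {X : Subset n} → ∣ X ∣ ≡ p → weight X ≡ v
    weight-p {X} eq = cong₂ w eq (+-cancelˡ-≡ p _ _
      (trans (cong (_+ ∣ ∁ X ∣) (sym eq)) (trans (∣X∣+∣∁X∣≡n X) (sym p+p′≡n))))

    -- Sets of layer p may be lighter than u; the deficit u − v is written without
    -- subtraction.
    local : ∀ X → F X * u + e X * v ≤ weight X * F X + e X * u
    local X with layer? p X
    ... | yes ∣X∣≡p rewrite weight-p {X} ∣X∣≡p = ≤-reflexive (swap (F X) u v)
      where
      swap : ∀ f u v → f * u + (f + 0) * v ≡ v * f + (f + 0) * u
      swap = solve-∀
    ... | no ∣X∣≢p = begin
      F X * u + 0         ≡⟨ cong (_+ 0) (*-comm (F X) u) ⟩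
      u * F X + 0         ≤⟨ +-monoˡ-≤ 0 (*-monoˡ-≤ (F X) (wq-minimal X ∣X∣≢p)) ⟩
      weight X * F X + 0  ∎
      where open ≤-Reasoning

    ∑P ∑Q total : ℕ
    ∑P = ∑ (λ X → weight X * ind (P? X))
    ∑Q = ∑ (λ X → weight X * ind (Q? X))
    total = count P? + count Q?

    ∑left : ∑ (λ X → F X * u + e X * v) ≡ total * u + a * v
    ∑left = trans (∑-+ (λ X → F X * u) _)
      (cong₂ _+_ (trans (∑-*ʳ F u) (cong (_* u) (∑-+ (λ X → ind (P? X)) _))) (∑-*ʳ e v))

    ∑right : ∑ (λ X → weight X * F X + e X * u) ≡ (∑P + ∑Q) + a * u
    ∑right = trans (∑-+ (λ X → weight X * F X) _)
      (cong₂ _+_ (trans (∑-cong (λ X → *-distribˡ-+ (weight X) (ind (P? X)) _))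
                        (∑-+ (λ X → weight X * ind (P? X)) _))
                 (∑-*ʳ e u))

    total≤ : total * u + a * v ≤ (∑P + ∑Q) + a * u
    total≤ = subst₂ _≤_ ∑left ∑right (∑-mono local)

    -- This says that `(M - a) * (u - v)` is nonnegative, without subtraction; `d` is `M - a`.
    rearrangement : a * u + M * v ≤ M * u + a * v
    rearrangement with m≤n⇒∃[o]m+o≡n a≤M
    ... | d , a+d≡M = begin
      a * u + M * v               ≡⟨ cong (λ m → a * u + m * v) (sym a+d≡M) ⟩
      a * u + (a + d) * v         ≡⟨ eq₁ a d u v ⟩
      a * u + a * v + d * v       ≤⟨ +-monoʳ-≤ (a * u + a * v) (*-monoʳ-≤ d wp≤wq) ⟩
      a * u + a * v + d * u       ≡⟨ eq₂ a d u v ⟩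
      (a + d) * u + a * v         ≡⟨ cong (λ m → m * u + a * v) a+d≡M ⟩
      M * u + a * v               ∎
      where
      open ≤-Reasoning
      eq₁ : ∀ a d u v → a * u + (a + d) * v ≡ a * u + a * v + d * v
      eq₁ = solve-∀
      eq₂ : ∀ a d u v → a * u + a * v + d * u ≡ (a + d) * u + a * v
      eq₂ = solve-∀

    ∑P+∑Q≤ : ∑P + ∑Q ≤ n ! + n !
    ∑P+∑Q≤ = +-mono-≤ (LYM P? P-antichain) (LYM Q? Q-antichain)

    upper : (n ! + n !) + a * u ≤ (M + N) * u + a * v
    upper = +-cancelʳ-≤ (M * v) _ _ (begin
      (n ! + n !) + a * u + M * v      ≡⟨ +-assoc (n ! + n !) _ _ ⟩
      (n ! + n !) + (a * u + M * v)    ≤⟨ +-monoʳ-≤ (n ! + n !) rearrangement ⟩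
      -- The two copies of `n !` are the weights of the full layers `p` and `q`.
      (n ! + n !) + (M * u + a * v)    ≡⟨ cong₂ (λ b c → (b + c) + (M * u + a * v))
                                            (sym (C*w p p′ p+p′≡n)) (sym (C*w q q′ q+q′≡n)) ⟩
      (M * v + N * u) + (M * u + a * v) ≡⟨ eq M N a u v ⟩
      (M + N) * u + a * v + M * v      ∎)
      where
      open ≤-Reasoning
      eq : ∀ M N a u v → (M * v + N * u) + (M * u + a * v) ≡ (M + N) * u + a * v + M * v
      eq = solve-∀

  -- Counting every member at weight `u` overestimates the actual weight by at most `a * (u - v)`,
  -- hence by at most `M * (u - v)`. Added to `n ! + n !`, that is `M * v + N * u`, this gives
  -- `(M + N) * u`.
  two-antichains : total ≤ M + N
  two-antichains = *-cancelʳ-≤ total (M + N) u {{w≢0 q q′}}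
    (+-cancelʳ-≤ (a * v) _ _ (≤-trans total≤ (≤-trans (+-monoˡ-≤ (a * u) ∑P+∑Q≤) upper)))

  module _ (tight : M + N ≤ total) where

    private
      upper-tight : (n ! + n !) + a * u ≤ total * u + a * v
      upper-tight = ≤-trans upper (+-monoˡ-≤ (a * v) (*-monoˡ-≤ u tight))

    LYM-both-tight : n ! ≤ ∑P × n ! ≤ ∑Q
    LYM-both-tight = +-squeeze (LYM P? P-antichain) (LYM Q? Q-antichain)
      (+-cancelʳ-≤ (a * u) _ _ (≤-trans upper-tight total≤))

    -- At a member off layer `p`, `F X` is 1 and `e X` is 0, so equality in `local` compares its
    -- weight directly with `u`.
    weight-tight : ∀ X → P X ⊎ Q X → ∣ X ∣ ≢ p → weight X ≤ u
    weight-tight X PQX ∣X∣≢p with ∑-squeeze local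
      (subst₂ _≤_ (sym ∑right) (sym ∑left) (≤-trans (+-monoˡ-≤ (a * u) ∑P+∑Q≤) upper-tight)) X
    ... | le with layer? p X
    ... | yes ∣X∣≡p = contradiction ∣X∣≡p ∣X∣≢p
    ... | no _ = subst₂ _≤_ (*-identityʳ (weight X)) (*-identityˡ u)
      (+-cancelʳ-≤ 0 _ _ (subst (λ m → weight X * m + 0 ≤ m * u + 0) F≡1 le))
      where
      F≡1 : F X ≡ 1
      F≡1 = ≤-antisym (F≤1 X)
        ([ (λ PX → ≤-trans (≤-reflexive (sym (ind-yes (P? X) PX))) (m≤m+n _ _))
         , (λ QX → ≤-trans (≤-reflexive (sym (ind-yes (Q? X) QX))) (m≤n+m _ _)) ]′ PQX)

-- Sets of extremal weight

∁-involutive : (X : Subset n) → ∁ (∁ X) ≡ X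
∁-involutive []            = refl
∁-involutive (inside ∷ X)  = cong (inside ∷_) (∁-involutive X)
∁-involutive (outside ∷ X) = cong (outside ∷_) (∁-involutive X)

-- The second alternative is the first for the complement, because `w` is symmetric; this is how the
-- size `d` arises.
weight-minimal : ∀ {c d} → c ≤ d → (X : Subset n) → c + d ≡ n → ∣ X ∣ ≤ c ⊎ ∣ ∁ X ∣ ≤ c →
                 w c d ≤ weight X × (weight X ≤ w c d → ∣ X ∣ ≡ c ⊎ ∣ X ∣ ≡ d)
weight-minimal c≤d X c+d≡n (inj₁ le) =
  Product.map id (inj₁ ∘_) (w-minimal c≤d le (trans (∣X∣+∣∁X∣≡n X) (sym c+d≡n)))
weight-minimal {c = c} {d} c≤d X c+d≡n (inj₂ le) rewrite w-comm ∣ X ∣ ∣ ∁ X ∣ =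
  Product.map id (λ f ge → inj₂ (+-cancelˡ-≡ c _ _ (trans (cong (_+ ∣ X ∣) (sym (f ge))) ∁X+X≡c+d)))
              (w-minimal c≤d le ∁X+X≡c+d)
  where
  ∁X+X≡c+d : ∣ ∁ X ∣ + ∣ X ∣ ≡ c + d
  ∁X+X≡c+d = trans (+-comm ∣ ∁ X ∣ _) (trans (∣X∣+∣∁X∣≡n X) (sym c+d≡n))

≤⊎∁≤ : ∀ {c d} → (X : Subset n) → c + suc d ≡ n → ∣ X ∣ ≤ c ⊎ ∣ ∁ X ∣ ≤ d
≤⊎∁≤ {c = c} {d} X eq with ≤-<-connex ∣ X ∣ c
... | inj₁ le = inj₁ le
... | inj₂ gt = inj₂ (+-cancelˡ-≤ (suc c) _ _ (begin
  suc c + ∣ ∁ X ∣  ≤⟨ +-monoˡ-≤ ∣ ∁ X ∣ gt ⟩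
  ∣ X ∣ + ∣ ∁ X ∣  ≡⟨ trans (∣X∣+∣∁X∣≡n X) (trans (sym eq) (+-suc c d)) ⟩
  suc c + d        ∎))
  where open ≤-Reasoning

-- The parity of `n`, with the summands chosen as sizes of layers: the two middle ones for odd `n`,
-- the two neighbours of the middle one for even `n`.
middle-sizes : 1 ≤ n → (∃ λ m → m + suc m ≡ n) ⊎ (∃ λ l → l + suc (suc l) ≡ n)
middle-sizes {suc zero}    _ = inj₁ (0 , refl)
middle-sizes {suc (suc n)} _ with middle-sizes {suc n} (s≤s z≤n)
... | inj₁ (m , eq) = inj₂ (m , trans (+-suc m (suc m)) (cong suc eq))
... | inj₂ (l , eq) = inj₁ (suc l , cong suc eq)

-- Cross-intersecting antichains

module _ {P R : Subset n → Set} (P? : Decidable P) (R? : Decidable R)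
         (P-antichain : IsAntichain P) (R-antichain : IsAntichain R)
         (cross : ∀ {X Y} → P X → R Y → Nonempty (X ∩ Y)) where

  private
    Q : Subset n → Set
    Q = R ∘ ∁

    Q? : Decidable Q
    Q? = R? ∘ ∁

    Q-antichain : IsAntichain Q
    Q-antichain {X} {Y} QX QY X⊆Y =
      trans (sym (∁-involutive X)) (trans (cong ∁ (sym (R-antichain QY QX (p⊆q⇒∁p⊇∁q X⊆Y)))) (∁-involutive Y))

    P⊈Q : ∀ {X Y} → P X → Q Y → ¬ X ⊆ Y
    P⊈Q {X} {Y} PX QY X⊆Y with cross PX QY
    ... | x , x∈X∩∁Y with x∈p∩q⁻ X (∁ Y) x∈X∩∁Y
    ... | x∈X , x∈∁Y = x∈∁p⇒x∉p x∈∁Y (X⊆Y x∈X)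

    disjoint : ∀ {X} → P X → ¬ Q X
    disjoint PX QX = P⊈Q PX QX ⊆-refl

    count-Q : count Q? ≡ count R?
    count-Q = ∑-∁ (λ X → ind (R? X))

  -- What equality yields before the sizes are determined. `X` represents the layer of `P`, and `Y`
  -- the layer of the complements of the members of `R`.
  TwoLayers : ℕ → ℕ → Set
  TwoLayers p u =
    ∃₂ λ (X Y : Subset n) → P ≐ Layer n ∣ X ∣ × R ≐ Layer n ∣ ∁ Y ∣ × ∣ Y ∣ < ∣ X ∣
      × (∣ X ∣ ≢ p → weight X ≤ u) × (∣ Y ∣ ≢ p → weight Y ≤ u)

  module _ (p p′ q q′ : ℕ) (p+p′≡n : p + p′ ≡ n) (q+q′≡n : q + q′ ≡ n)
           (wp≤wq : w p p′ ≤ w q q′)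
           (wq-minimal : ∀ (X : Subset n) → ∣ X ∣ ≢ p → w q q′ ≤ weight X) where

    cross-bound : count P? + count R? ≤ n C p + n C q
    cross-bound = subst (λ m → count P? + m ≤ n C p + n C q) count-Q
      (two-antichains P? Q? P-antichain Q-antichain disjoint p p′ q q′ p+p′≡n q+q′≡n wp≤wq wq-minimal)

    cross-tight : n C p + n C q ≤ count P? + count R? → TwoLayers p (w q q′)
    cross-tight le
      with LYM-both-tight P? Q? P-antichain Q-antichain disjoint p p′ q q′ p+p′≡n q+q′≡n wp≤wq wq-minimal le′
         | weight-tight P? Q? P-antichain Q-antichain disjoint p p′ q q′ p+p′≡n q+q′≡n wp≤wq wq-minimal le′
      where
      le′ : n C p + n C q ≤ count P? + count Q?
      le′ = subst (λ m → n C p + n C q ≤ count P? + m) (sym count-Q) le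
    ... | P-tight , Q-tight | near
      with LYM-tight P? P-antichain P-tight | LYM-tight Q? Q-antichain Q-tight
    ... | X , PX , P⊆ , ⊆P | Y , QY , Q⊆ , ⊆Q =
      X , Y , ((λ {Z} → P⊆ Z) , (λ {Z} → ⊆P Z)) , (R⊆ , ⊆R) , Y<X , near X (inj₁ PX) , near Y (inj₂ QY)
      where
      ∁-size : ∀ {Z W : Subset n} → ∣ Z ∣ ≡ ∣ W ∣ → ∣ ∁ Z ∣ ≡ ∣ ∁ W ∣
      ∁-size {Z} {W} eq = trans (∣∁p∣≡n∸∣p∣ Z) (trans (cong (n ∸_) eq) (sym (∣∁p∣≡n∸∣p∣ W)))

      R⊆ : ∀ {Z} → R Z → ∣ Z ∣ ≡ ∣ ∁ Y ∣
      R⊆ {Z} RZ = trans (cong ∣_∣ (sym (∁-involutive Z)))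
        (∁-size {∁ Z} {Y} (Q⊆ (∁ Z) (subst R (sym (∁-involutive Z)) RZ)))

      ⊆R : ∀ {Z} → ∣ Z ∣ ≡ ∣ ∁ Y ∣ → R Z
      ⊆R {Z} eq = subst R (∁-involutive Z)
        (⊆Q (∁ Z) (trans (∁-size {Z} {∁ Y} eq) (cong ∣_∣ (∁-involutive Y))))

      Y<X : ∣ Y ∣ < ∣ X ∣
      -- Otherwise `Y` contains a set of size `∣ X ∣`, which is in `P` because `P` is a full layer.
      Y<X = ≰⇒> λ X≤Y → let Z , Z⊆Y , ∣Z∣≡ = subset-of-size Y X≤Y in P⊈Q (⊆P Z ∣Z∣≡) QY Z⊆Y

  -- Identifying the layers for odd and even ground sets

  BoundWithLayers : ℕ → ℕ → Set
  BoundWithLayers p q =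
    count P? + count R? ≤ n C p + n C q ×
    (n C p + n C q ≤ count P? + count R? →
      (P ≐ Layer n p × R ≐ Layer n q) ⊎ (P ≐ Layer n q × R ≐ Layer n p))

  private
    ∣∁∣-from : ∀ {i j} (Y : Subset n) → i + j ≡ n → ∣ Y ∣ ≡ i → ∣ ∁ Y ∣ ≡ j
    ∣∁∣-from {i} Y i+j≡n refl = +-cancelˡ-≡ i _ _ (trans (∣X∣+∣∁X∣≡n Y) (sym i+j≡n))

  -- The layers `m` and `suc m` tie for lightest and have equal sizes, so `suc m` serves as both `p`
  -- and `q`. In the equality case `∣ Y ∣ < ∣ X ∣` forces the sizes `m` and `suc m`, and
  -- complementing `Y` gives `suc m` twice.
  odd-case : ∀ m → m + suc m ≡ n → BoundWithLayers (suc m) (suc m)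
  odd-case m m+1+m≡n =
    cross-bound (suc m) m (suc m) m sum sum ≤-refl minimal ,
    λ le → layers (cross-tight (suc m) m (suc m) m sum sum ≤-refl minimal le)
    where
    sum : suc m + m ≡ n
    sum = trans (+-comm (suc m) m) m+1+m≡n

    middle : ∀ X → w m (suc m) ≤ weight X × (weight X ≤ w m (suc m) → ∣ X ∣ ≡ m ⊎ ∣ X ∣ ≡ suc m)
    middle X = weight-minimal (n≤1+n m) X m+1+m≡n (≤⊎∁≤ X m+1+m≡n)

    minimal : ∀ X → ∣ X ∣ ≢ suc m → w (suc m) m ≤ weight X
    minimal X _ = subst (_≤ weight X) (w-comm m (suc m)) (proj₁ (middle X))

    sizes : ∀ X → (∣ X ∣ ≢ suc m → weight X ≤ w (suc m) m) → ∣ X ∣ ≡ m ⊎ ∣ X ∣ ≡ suc m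
    sizes X near with ∣ X ∣ ≟ suc m
    ... | yes eq = inj₂ eq
    ... | no neq = proj₂ (middle X) (subst (weight X ≤_) (w-comm (suc m) m) (near neq))

    layers : TwoLayers (suc m) (w (suc m) m) →
             (P ≐ Layer n (suc m) × R ≐ Layer n (suc m)) ⊎ (P ≐ Layer n (suc m) × R ≐ Layer n (suc m))
    layers (X , Y , P≐ , R≐ , Y<X , nearX , nearY) with sizes X nearX | sizes Y nearY
    ... | inj₂ X≡ | inj₁ Y≡ = inj₁
      ( subst (λ k → P ≐ Layer n k) X≡ P≐
      , subst (λ k → R ≐ Layer n k) (∣∁∣-from Y m+1+m≡n Y≡) R≐ )
    ... | inj₁ X≡ | inj₁ Y≡ = contradiction (subst₂ _<_ Y≡ X≡ Y<X) (<-irrefl refl)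
    ... | inj₁ X≡ | inj₂ Y≡ = contradiction (subst₂ _<_ Y≡ X≡ Y<X) (≤⇒≯ (n≤1+n m))
    ... | inj₂ X≡ | inj₂ Y≡ = contradiction (subst₂ _<_ Y≡ X≡ Y<X) (<-irrefl refl)

  -- Layer `suc l` alone is lightest, and its neighbours `l` and `suc (suc l)` tie for second. Of
  -- the pairs of sizes with `∣ Y ∣ < ∣ X ∣`, the two containing `suc l` give the two orders of the
  -- layers.
  even-case : ∀ l → l + suc (suc l) ≡ n → BoundWithLayers (suc l) (suc (suc l))
  even-case l l+2+l≡n =
    cross-bound p p q l sum-p sum-q wp≤wq minimal ,
    λ le → layers le (cross-tight p p q l sum-p sum-q wp≤wq minimal le)
    where
    p q : ℕ
    p = suc l
    q = suc (suc l)

    sum-p : p + p ≡ n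
    sum-p = trans (sym (+-suc l p)) l+2+l≡n

    sum-q : q + l ≡ n
    sum-q = trans (+-comm q l) l+2+l≡n

    wp<wq : w p p < w q l
    wp<wq = subst (w p p <_) (w-comm l q) (w-step {l} {p} ≤-refl)

    wp≤wq : w p p ≤ w q l
    wp≤wq = <⇒≤ wp<wq

    middle : ∀ X → ∣ X ∣ ≢ p → w l q ≤ weight X × (weight X ≤ w l q → ∣ X ∣ ≡ l ⊎ ∣ X ∣ ≡ q)
    middle X X≢p = weight-minimal (m≤n+m l 2) X l+2+l≡n (outer (≤⊎∁≤ X l+2+l≡n))
      where
      outer : ∣ X ∣ ≤ l ⊎ ∣ ∁ X ∣ ≤ p → ∣ X ∣ ≤ l ⊎ ∣ ∁ X ∣ ≤ l
      outer (inj₁ le) = inj₁ le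
      outer (inj₂ le) with m≤n⇒m<n∨m≡n le
      ... | inj₁ (s≤s lt) = inj₂ lt
      -- As `n` is `p + p`, a complement of size `p` would give `X` the excluded size `p`.
      ... | inj₂ eq = contradiction
        (+-cancelʳ-≡ p _ _ (trans (cong (∣ X ∣ +_) (sym eq)) (trans (∣X∣+∣∁X∣≡n X) (sym sum-p)))) X≢p

    minimal : ∀ X → ∣ X ∣ ≢ p → w q l ≤ weight X
    minimal X X≢p = subst (_≤ weight X) (w-comm l q) (proj₁ (middle X X≢p))

    sizes : ∀ X → (∣ X ∣ ≢ p → weight X ≤ w q l) → ∣ X ∣ ≡ l ⊎ ∣ X ∣ ≡ p ⊎ ∣ X ∣ ≡ q
    sizes X near with ∣ X ∣ ≟ p
    ... | yes eq = inj₂ (inj₁ eq)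
    ... | no neq = Sum.map₂ inj₂ (proj₂ (middle X neq) (subst (weight X ≤_) (w-comm q l) (near neq)))

    -- Size times weight is `n !` on every layer, so the strictly lighter layer is strictly larger.
    C-strict : n C q < n C p
    C-strict = ≰⇒> λ p≤q → <⇒≱ wp<wq (*-cancelˡ-≤ (n C p) {{Cp≢0}} (begin
      (n C p) * w q l  ≤⟨ *-monoˡ-≤ (w q l) p≤q ⟩
      (n C q) * w q l  ≡⟨ trans (C*w q l sum-q) (sym (C*w p p sum-p)) ⟩
      (n C p) * w p p  ∎))
      where
      open ≤-Reasoning
      Cp≢0 : NonZero (n C p)
      Cp≢0 = m*n≢0⇒m≢0 (n C p) {{subst NonZero (sym (C*w p p sum-p)) (n !≢0)}}

    layers : n C p + n C q ≤ count P? + count R? → TwoLayers p (w q l) →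
             (P ≐ Layer n p × R ≐ Layer n q) ⊎ (P ≐ Layer n q × R ≐ Layer n p)
    layers le (X , Y , P≐ , R≐ , Y<X , nearX , nearY) with sizes X nearX | sizes Y nearY
    ... | inj₁ X≡l        | inj₁ Y≡l        = contradiction (subst₂ _<_ Y≡l X≡l Y<X) (<-irrefl refl)
    ... | inj₁ X≡l        | inj₂ (inj₁ Y≡p) = contradiction (subst₂ _<_ Y≡p X≡l Y<X) (≤⇒≯ (m≤n+m l 1))
    ... | inj₁ X≡l        | inj₂ (inj₂ Y≡q) = contradiction (subst₂ _<_ Y≡q X≡l Y<X) (≤⇒≯ (m≤n+m l 2))
    ... | inj₂ (inj₁ X≡p) | inj₂ (inj₁ Y≡p) = contradiction (subst₂ _<_ Y≡p X≡p Y<X) (<-irrefl refl)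
    ... | inj₂ (inj₁ X≡p) | inj₂ (inj₂ Y≡q) = contradiction (subst₂ _<_ Y≡q X≡p Y<X) (≤⇒≯ (m≤n+m p 1))
    ... | inj₂ (inj₂ X≡q) | inj₂ (inj₂ Y≡q) = contradiction (subst₂ _<_ Y≡q X≡q Y<X) (<-irrefl refl)
    ... | inj₂ (inj₁ X≡p) | inj₁ Y≡l = inj₁
      ( subst (λ k → P ≐ Layer n k) X≡p P≐
      , subst (λ k → R ≐ Layer n k) (∣∁∣-from Y l+2+l≡n Y≡l) R≐ )
    ... | inj₂ (inj₂ X≡q) | inj₂ (inj₁ Y≡p) = inj₂
      ( subst (λ k → P ≐ Layer n k) X≡q P≐
      , subst (λ k → R ≐ Layer n k) (∣∁∣-from Y sum-p Y≡p) R≐ )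
    -- Both families would be second-largest layers, and their total falls short.
    ... | inj₂ (inj₂ X≡q) | inj₁ Y≡l = contradiction
      (subst₂ (λ a b → n C p + n C q ≤ a + b)
        (trans (count≐layer P? P≐) (cong (n C_) X≡q))
        (trans (count≐layer R? R≐) (cong (n C_) (∣∁∣-from Y l+2+l≡n Y≡l))) le)
      (<⇒≱ (+-monoˡ-< (n C q) C-strict))

  middle-bound : 1 ≤ n → BoundWithLayers ⌊ n + 1 /2⌋ ⌈ n + 1 /2⌉
  middle-bound 1≤n with middle-sizes 1≤n
  ... | inj₁ (m , m+1+m≡n) = subst₂ BoundWithLayers
      (trans (n≡⌊n+n/2⌋ (suc m)) (cong ⌊_/2⌋ double)) (trans (n≡⌈n+n/2⌉ (suc m)) (cong ⌈_/2⌉ double))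
      (odd-case m m+1+m≡n)
    where
    double : suc m + suc m ≡ n + 1
    double = trans (cong suc m+1+m≡n) (+-comm 1 n)
  ... | inj₂ (l , l+2+l≡n) = subst₂ BoundWithLayers
      -- By definition `⌈ k /2⌉` is `⌊ suc k /2⌋`, so for the odd number `n + 1` the ceiling lemma
      -- supplies the floor and the floor lemma the ceiling.
      (trans (n≡⌈n+n/2⌉ (suc l)) (cong ⌊_/2⌋ double))
      (trans (cong suc (n≡⌊n+n/2⌋ (suc l))) (cong ⌈_/2⌉ double))
      (even-case l l+2+l≡n)
    where
    double : suc (suc l + suc l) ≡ n + 1
    double = trans (cong suc (trans (sym (+-suc l (suc l))) l+2+l≡n)) (+-comm 1 n)

-- Unordered pairs of families

module _ {P Q P′ Q′ : Pred (Subset n) 0ℓ} where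

  ｛｝-cong : P ≐ P′ → Q ≐ Q′ → ｛ P , Q ｝ ≐ ｛ P′ , Q′ ｝
  ｛｝-cong P≐P′ Q≐Q′ =
    Sum.map (λ F≐P → ≐-trans F≐P P≐P′) (λ F≐Q → ≐-trans F≐Q Q≐Q′) ,
    Sum.map (λ F≐P′ → ≐-trans F≐P′ (≐-sym P≐P′)) (λ F≐Q′ → ≐-trans F≐Q′ (≐-sym Q≐Q′))

  ｛｝-injective : ｛ P , Q ｝ ≐ ｛ P′ , Q′ ｝ → (P ≐ P′ × Q ≐ Q′) ⊎ (P ≐ Q′ × Q ≐ P′)
  ｛｝-injective (⊆′ , ⊇′) with ⊆′ (inj₁ ≐-refl) | ⊆′ (inj₂ ≐-refl) | ⊇′ (inj₁ ≐-refl) | ⊇′ (inj₂ ≐-refl)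
  ... | inj₁ P≐P′ | inj₂ Q≐Q′ | _         | _         = inj₁ (P≐P′ , Q≐Q′)
  ... | inj₂ P≐Q′ | inj₁ Q≐P′ | _         | _         = inj₂ (P≐Q′ , Q≐P′)
  -- When `P` and `Q` match the same member, the reverse inclusion decides which of them the other
  -- member matches.
  ... | inj₁ P≐P′ | inj₁ Q≐P′ | _         | inj₁ Q′≐P = inj₂ (≐-sym Q′≐P , Q≐P′)
  ... | inj₁ P≐P′ | inj₁ Q≐P′ | _         | inj₂ Q′≐Q = inj₁ (P≐P′ , ≐-sym Q′≐Q)
  ... | inj₂ P≐Q′ | inj₂ Q≐Q′ | inj₁ P′≐P | _         = inj₁ (≐-sym P′≐P , Q≐Q′)
  ... | inj₂ P≐Q′ | inj₂ Q≐Q′ | inj₂ P′≐Q | _         = inj₂ (P≐Q′ , ≐-sym P′≐Q)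

｛｝-comm : {P Q : Pred (Subset n) 0ℓ} → ｛ P , Q ｝ ≐ ｛ Q , P ｝
｛｝-comm = Sum.swap , Sum.swap

-- From decidable predicates to enumerated families

isAntichain : (ℱ : Family n) → Antichain ℱ → IsAntichain ⟦ ℱ ⟧
isAntichain ℱ ac {X} {Y} X∈ℱ Y∈ℱ X⊆Y =
  decidable-stable (X ≟ˢ Y) λ X≢Y → ac X∈ℱ Y∈ℱ X≢Y X⊆Y

module _ (𝒜 ℬ : Family n) (𝒜-antichain : Antichain 𝒜) (ℬ-antichain : Antichain ℬ)
         (cross : CrossIntersecting 𝒜 ℬ) where

  private
    𝒜? : Decidable ⟦ 𝒜 ⟧
    𝒜? = _∈? members 𝒜

    ℬ? : Decidable ⟦ ℬ ⟧
    ℬ? = _∈? members ℬ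

    cards : card 𝒜 + card ℬ ≡ count 𝒜? + count ℬ?
    cards = cong₂ _+_ (length≡count (unique 𝒜)) (length≡count (unique ℬ))

  bound⇒theorem : ∀ {p q} →
    BoundWithLayers 𝒜? ℬ? (isAntichain 𝒜 𝒜-antichain) (isAntichain ℬ ℬ-antichain) cross p q →
    card 𝒜 + card ℬ ≤ n C p + n C q ×
    (card 𝒜 + card ℬ ≡ n C p + n C q ⇔ ｛ ⟦ 𝒜 ⟧ , ⟦ ℬ ⟧ ｝ ≐ ｛ Layer n p , Layer n q ｝)
  bound⇒theorem {p} {q} (bound , layers) =
    subst (_≤ n C p + n C q) (sym cards) bound ,
    mk⇔
      (λ eq → [ (λ (A≐ , B≐) → ｛｝-cong A≐ B≐)
              , (λ (A≐ , B≐) → ≐-trans (｛｝-cong A≐ B≐) ｛｝-comm)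
              ]′ (layers (≤-reflexive (trans (sym eq) cards))))
      -- Equal pairs match in one of two orders, and either order gives the same sum of layer sizes.
      (λ same → trans cards
        ([ (λ (A≐ , B≐) → cong₂ _+_ (count≐layer 𝒜? A≐) (count≐layer ℬ? B≐))
         , (λ (A≐ , B≐) → trans (cong₂ _+_ (count≐layer 𝒜? A≐) (count≐layer ℬ? B≐)) (+-comm (n C q) _))
         ]′ (｛｝-injective same)))

theorem1p4 : (n : ℕ) → n ≥ 3 → (𝒜 ℬ : Family n) →
    Antichain 𝒜 → Antichain ℬ → CrossIntersecting 𝒜 ℬ →
    (card 𝒜 + card ℬ ≤ (n C ⌊ n + 1 /2⌋) + (n C ⌈ n + 1 /2⌉))
    × ((card 𝒜 + card ℬ ≡ (n C ⌊ n + 1 /2⌋) + (n C ⌈ n + 1 /2⌉))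
    ⇔ (｛ ⟦ 𝒜 ⟧ , ⟦ ℬ ⟧ ｝ ≐ ｛ Layer n ⌊ n + 1 /2⌋ , Layer n ⌈ n + 1 /2⌉ ｝))
theorem1p4 n n≥3 𝒜 ℬ 𝒜-antichain ℬ-antichain cross =
  bound⇒theorem 𝒜 ℬ 𝒜-antichain ℬ-antichain cross
    (middle-bound (_∈? members 𝒜) (_∈? members ℬ)
      (isAntichain 𝒜 𝒜-antichain) (isAntichain ℬ ℬ-antichain) cross (≤-trans (s≤s z≤n) n≥3))
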